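{- Let $G=(V,E)$ be a finite simple undirected graph. With the notation of the context (non-induced counts $|M_a^{(5)}|$ and induced counts $|\widetilde{M}_a^{(5)}|$), the following hold: $|\widetilde{M}_{75}^{(5)}| = |M_{75}^{(5)}| - |M_{79}^{(5)}| + |M_{95}^{(5)}| - |M_{127}^{(5)}| - 2 |M_{223}^{(5)}| + |M_{235}^{(5)}| - |M_{239}^{(5)}| + 2 |M_{255}^{(5)}| + |M_{507}^{(5)}| - 3 |M_{511}^{(5)}| + 5 |M_{1023}^{(5)}|$; $|\widetilde{M}_{77}^{(5)}| = |M_{77}^{(5)}| - 2 |M_{79}^{(5)}| - 2 |M_{87}^{(5)}| - 2 |M_{94}^{(5)}| + 5 |M_{95}^{(5)}| - |M_{117}^{(5)}| + 4 |M_{119}^{(5)}| - 9 |M_{127}^{(5)}| + 6 |M_{222}^{(5)}| - 12 |M_{223}^{(5)}| + 4 |M_{235}^{(5)}| + 4 |M_{237}^{(5)}| - 10 |M_{239}^{(5)}| - 10 |M_{254}^{(5)}| + 20 |M_{255}^{(5)}| + 20 |M_{507}^{(5)}| - 36 |M_{511}^{(5)}| + 60 |M_{1023}^{(5)}|$; $|\widetilde{M}_{79}^{(5)}| = |M_{79}^{(5)}| - 2 |M_{95}^{(5)}| + 3 |M_{127}^{(5)}| + 6 |M_{223}^{(5)}| - 2 |M_{235}^{(5)}| + 3 |M_{239}^{(5)}| - 8 |M_{255}^{(5)}| - 4 |M_{507}^{(5)}| + 15 |M_{511}^{(5)}| - 30 |M_{1023}^{(5)}|$; $|\widetilde{M}_{86}^{(5)}|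 = |M_{86}^{(5)}| - |M_{87}^{(5)}| - 2 |M_{94}^{(5)}| + 2 |M_{95}^{(5)}| - 2 |M_{117}^{(5)}| + 4 |M_{119}^{(5)}| - 6 |M_{127}^{(5)}| + 6 |M_{222}^{(5)}| - 6 |M_{223}^{(5)}| + 4 |M_{235}^{(5)}| - 5 |M_{236}^{(5)}| + 7 |M_{237}^{(5)}| - 10 |M_{239}^{(5)}| - 14 |M_{254}^{(5)}| + 18 |M_{255}^{(5)}| + 24 |M_{507}^{(5)}| - 36 |M_{511}^{(5)}| + 60 |M_{1023}^{(5)}|$; $|\widetilde{M}_{87}^{(5)}| = |M_{87}^{(5)}| - 2 |M_{95}^{(5)}| - 2 |M_{119}^{(5)}| + 6 |M_{127}^{(5)}| + 6 |M_{223}^{(5)}| - |M_{237}^{(5)}| + 5 |M_{239}^{(5)}| + 4 |M_{254}^{(5)}| - 14 |M_{255}^{(5)}| - 12 |M_{507}^{(5)}| + 30 |M_{511}^{(5)}| - 60 |M_{1023}^{(5)}|$; $|\widetilde{M}_{94}^{(5)}| = |M_{94}^{(5)}| - |M_{95}^{(5)}| - |M_{119}^{(5)}| + 3 |M_{127}^{(5)}| - 6 |M_{222}^{(5)}| + 6 |M_{223}^{(5)}| - 2 |M_{237}^{(5)}| + 4 |M_{239}^{(5)}| + 8 |M_{254}^{(5)}| - 12 |M_{255}^{(5)}| - 16 |M_{507}^{(5)}| + 30 |M_{511}^{(5)}| - 60 |M_{1023}^{(5)}|$; $|\widetilde{M}_{95}^{(5)}| = |M_{95}^{(5)}| - 3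 |M_{127}^{(5)}| - 6 |M_{223}^{(5)}| - 2 |M_{239}^{(5)}| + 10 |M_{255}^{(5)}| + 4 |M_{507}^{(5)}| - 24 |M_{511}^{(5)}| + 60 |M_{1023}^{(5)}|$; $|\widetilde{M}_{117}^{(5)}| = |M_{117}^{(5)}| - 2 |M_{119}^{(5)}| + 3 |M_{127}^{(5)}| - 4 |M_{235}^{(5)}| - 2 |M_{237}^{(5)}| + 6 |M_{239}^{(5)}| + 6 |M_{254}^{(5)}| - 12 |M_{255}^{(5)}| - 16 |M_{507}^{(5)}| + 30 |M_{511}^{(5)}| - 60 |M_{1023}^{(5)}|$; $|\widetilde{M}_{119}^{(5)}| = |M_{119}^{(5)}| - 3 |M_{127}^{(5)}| - 2 |M_{239}^{(5)}| - 2 |M_{254}^{(5)}| + 8 |M_{255}^{(5)}| + 8 |M_{507}^{(5)}| - 24 |M_{511}^{(5)}| + 60 |M_{1023}^{(5)}|$; $|\widetilde{M}_{127}^{(5)}| = |M_{127}^{(5)}| - 2 |M_{255}^{(5)}| + 6 |M_{511}^{(5)}| - 20 |M_{1023}^{(5)}|$; $|\widetilde{M}_{222}^{(5)}| = |M_{222}^{(5)}| - |M_{223}^{(5)}| - |M_{254}^{(5)}| + |M_{255}^{(5)}| + 2 |M_{507}^{(5)}| - 4 |M_{511}^{(5)}| + 10 |M_{1023}^{(5)}|$; $|\widetilde{M}_{223}^{(5)}| = |M_{223}^{(5)}| - |M_{255}^{(5)}| + 3 |M_{511}^{(5)}| - 10 |M_{1023}^{(5)}|$; $|\widetilde{M}_{235}^{(5)}|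 = |M_{235}^{(5)}| - |M_{239}^{(5)}| + 2 |M_{255}^{(5)}| + 2 |M_{507}^{(5)}| - 6 |M_{511}^{(5)}| + 15 |M_{1023}^{(5)}|$; $|\widetilde{M}_{236}^{(5)}| = |M_{236}^{(5)}| - |M_{237}^{(5)}| + |M_{239}^{(5)}| + 2 |M_{254}^{(5)}| - 2 |M_{255}^{(5)}| - 4 |M_{507}^{(5)}| + 6 |M_{511}^{(5)}| - 12 |M_{1023}^{(5)}|$; $|\widetilde{M}_{237}^{(5)}| = |M_{237}^{(5)}| - 2 |M_{239}^{(5)}| - 4 |M_{254}^{(5)}| + 6 |M_{255}^{(5)}| + 12 |M_{507}^{(5)}| - 24 |M_{511}^{(5)}| + 60 |M_{1023}^{(5)}|$; $|\widetilde{M}_{239}^{(5)}| = |M_{239}^{(5)}| - 4 |M_{255}^{(5)}| - 4 |M_{507}^{(5)}| + 18 |M_{511}^{(5)}| - 60 |M_{1023}^{(5)}|$; $|\widetilde{M}_{254}^{(5)}| = |M_{254}^{(5)}| - |M_{255}^{(5)}| - 4 |M_{507}^{(5)}| + 9 |M_{511}^{(5)}| - 30 |M_{1023}^{(5)}|$; $|\widetilde{M}_{255}^{(5)}| = |M_{255}^{(5)}| - 6 |M_{511}^{(5)}| + 30 |M_{1023}^{(5)}|$; $|\widetilde{M}_{507}^{(5)}| = |M_{507}^{(5)}| - 3 |M_{511}^{(5)}| + 15 |M_{1023}^{(5)}|$; $|\widetilde{M}_{511}^{(5)}| = |M_{511}^{(5)}| - 10 |M_{1023}^{(5)}|$; $|\widetilde{M}_{1023}^{(5)}|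 = |M_{1023}^{(5)}|$.
   Context: For a fixed graph $F$ on five vertices, $|F|$ (non-induced count) is the number of subgraphs of $G$ (a vertex subset together with an edge subset) isomorphic to $F$, and $|\widetilde{F}|$ (induced count) is the number of $5$-element vertex subsets $W\subseteq V$ such that the induced subgraph $G[W]$ is isomorphic to $F$. The graphs $M_a^{(5)}$ are given by their edge sets on vertex set $\{1,\dots,5\}$: $M_{75}^{(5)}$: $\{15,25,35,45\}$; $M_{77}^{(5)}$: $\{15,25,35,34\}$; $M_{79}^{(5)}$: $\{15,25,34,35,45\}$; $M_{86}^{(5)}$: $\{15,24,34,35\}$; $M_{87}^{(5)}$: $\{15,24,34,35,45\}$; $M_{94}^{(5)}$: $\{15,24,25,34,35\}$; $M_{95}^{(5)}$: $\{15,24,25,34,35,45\}$; $M_{117}^{(5)}$: $\{15,23,24,34,45\}$; $M_{119}^{(5)}$: $\{15,23,24,34,35,45\}$; $M_{127}^{(5)}$: $\{15,23,24,25,34,35,45\}$; $M_{222}^{(5)}$: $\{14,15,24,25,34,35\}$; $M_{223}^{(5)}$: $\{14,15,24,25,34,35,45\}$; $M_{235}^{(5)}$: $\{14,15,23,25,35,45\}$; $M_{236}^{(5)}$: $\{14,15,23,25,34\}$; $M_{237}^{(5)}$: $\{14,15,23,25,34,45\}$; $M_{239}^{(5)}$: $\{14,15,23,25,34,35,45\}$; $M_{254}^{(5)}$: $\{14,15,23,24,25,34,35\}$; $M_{255}^{(5)}$: $\{14,15,23,24,25,34,35,45\}$; $M_{507}^{(5)}$: $\{13,14,15,23,24,25,35,45\}$;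 $M_{511}^{(5)}$: all pairs except $12$; $M_{1023}^{(5)}$: $K_5$. Write $|M_a^{(5)}|$ and $|\widetilde{M}_a^{(5)}|$ for the non-induced and induced counts of $M_a^{(5)}$ in $G$. -}

module Defs where

open import Data.Bool using (Bool; true; false; _∧_; _∨_; if_then_else_; T)
open import Data.Nat using (ℕ; zero; suc)
open import Data.Fin using (Fin; toℕ; _<?_; _≟_)
open import Data.List using (List; []; _∷_; concatMap; filter; length; map; allFin; _++_)
open import Data.Bool.ListAction using (all; any)
open import Data.Nat.ListAction using (sum)
open import Data.Product using (_×_; _,_; proj₁; proj₂)
open import Relation.Nullary.Decidable using (⌊_⌋)
open import Relation.Binary.PropositionalEquality using (_≡_)
import Data.Nat as ℕ

record Graph (n : ℕ) : Set where
  field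
    adj    : Fin n → Fin n → Bool
    sym    : ∀ i j → adj i j ≡ adj j i
    irrefl : ∀ i → adj i i ≡ false
open Graph public

Adj5 : Set
Adj5 = Fin 5 → Fin 5 → Bool

_==_ : ∀ {m} → Fin m → Fin m → Bool
i == j = ⌊ i ≟ j ⌋

eqB : Bool → Bool → Bool
eqB true  b = b
eqB false b = Data.Bool.not b

fromEdges : List (Fin 5 × Fin 5) → Adj5
fromEdges es i j = any (λ e → ((proj₁ e == i) ∧ (proj₂ e == j)) ∨ ((proj₁ e == j) ∧ (proj₂ e == i))) es

-- edges written with 1-based vertex labels as in the paper: vertex k ↦ Fin index k-1
v : ℕ → Fin 5
v 2 = Data.Fin.suc Data.Fin.zero
v 3 = Data.Fin.suc (Data.Fin.suc Data.Fin.zero)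
v 4 = Data.Fin.suc (Data.Fin.suc (Data.Fin.suc Data.Fin.zero))
v 5 = Data.Fin.suc (Data.Fin.suc (Data.Fin.suc (Data.Fin.suc Data.Fin.zero)))
v _ = Data.Fin.zero

pat : List (ℕ × ℕ) → Adj5
pat es = fromEdges (map (λ e → v (proj₁ e) , v (proj₂ e)) es)

allFin5Maps : List (Fin 5 → Fin 5)
allFin5Maps =
  concatMap (λ a → concatMap (λ b → concatMap (λ c → concatMap (λ d → map (λ e → mk a b c d e)
    (allFin 5)) (allFin 5)) (allFin 5)) (allFin 5)) (allFin 5)
  where
  mk : Fin 5 → Fin 5 → Fin 5 → Fin 5 → Fin 5 → Fin 5 → Fin 5
  mk a b c d e Data.Fin.zero = a
  mk a b c d e (Data.Fin.suc Data.Fin.zero) = b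
  mk a b c d e (Data.Fin.suc (Data.Fin.suc Data.Fin.zero)) = c
  mk a b c d e (Data.Fin.suc (Data.Fin.suc (Data.Fin.suc Data.Fin.zero))) = d
  mk a b c d e (Data.Fin.suc (Data.Fin.suc (Data.Fin.suc (Data.Fin.suc Data.Fin.zero)))) = e

injectiveB : (Fin 5 → Fin 5) → Bool
injectiveB σ = all (λ i → all (λ j → Data.Bool.not (σ i == σ j) ∨ (i == j)) (allFin 5)) (allFin 5)

perms5 : List (Fin 5 → Fin 5)
perms5 = filter (λ σ → T? (injectiveB σ)) allFin5Maps
  where
  open import Data.Bool.Properties using (T?)

isIso : Adj5 → Adj5 → Bool
isIso H F = any (λ σ → all (λ i → all (λ j → eqB (H i j) (F (σ i) (σ j))) (allFin 5)) (allFin 5)) perms5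

-- 5-element vertex subsets W ⊆ Fin n, each listed once via its strictly
-- increasing enumeration w : Fin 5 → Fin n.

allMaps : (n : ℕ) → List (Fin 5 → Fin n)
allMaps n =
  concatMap (λ a → concatMap (λ b → concatMap (λ c → concatMap (λ d → map (λ e → mk a b c d e)
    (allFin n)) (allFin n)) (allFin n)) (allFin n)) (allFin n)
  where
  mk : Fin n → Fin n → Fin n → Fin n → Fin n → Fin 5 → Fin n
  mk a b c d e Data.Fin.zero = a
  mk a b c d e (Data.Fin.suc Data.Fin.zero) = b
  mk a b c d e (Data.Fin.suc (Data.Fin.suc Data.Fin.zero)) = c
  mk a b c d e (Data.Fin.suc (Data.Fin.suc (Data.Fin.suc Data.Fin.zero))) = d
  mk a b c d e (Data.Fin.suc (Data.Fin.suc (Data.Fin.suc (Data.Fin.suc Data.Fin.zero)))) = e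

strictlyIncreasing : ∀ {n} → (Fin 5 → Fin n) → Bool
strictlyIncreasing w = all (λ i → all (λ j → Data.Bool.not ⌊ i <? j ⌋ ∨ ⌊ w i <? w j ⌋) (allFin 5)) (allFin 5)

fiveSubsets : (n : ℕ) → List (Fin 5 → Fin n)
fiveSubsets n = filter (λ w → T? (strictlyIncreasing w)) (allMaps n)
  where
  open import Data.Bool.Properties using (T?)

induced : ∀ {n} → Graph n → (Fin 5 → Fin n) → Adj5
induced G w i j = adj G (w i) (w j)

pairs5 : List (Fin 5 × Fin 5)
pairs5 = concatMap (λ i → concatMap (λ j → if ⌊ i <? j ⌋ then (i , j) ∷ [] else []) (allFin 5)) (allFin 5)

sublists : ∀ {A : Set} → List A → List (List A)
sublists []       = [] ∷ []
sublists (x ∷ xs) = let r = sublists xs in r ++ map (x ∷_) r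

edgeSubsets : ∀ {n} → Graph n → (Fin 5 → Fin n) → List (List (Fin 5 × Fin 5))
edgeSubsets G w = sublists (filter (λ e → T? (induced G w (proj₁ e) (proj₂ e))) pairs5)
  where
  open import Data.Bool.Properties using (T?)

countB : ∀ {A : Set} → (A → Bool) → List A → ℕ
countB p xs = length (filter (λ x → T? (p x)) xs)
  where
  open import Data.Bool.Properties using (T?)

-- |F| : number of subgraphs (vertex subset W together with an edge subset
-- E' ⊆ E(G[W])) isomorphic to F.  (F has 5 vertices, so |W| = 5.)
nonInd : ∀ {n} → Graph n → Adj5 → ℕ
nonInd {n} G F = sum (map (λ w → countB (λ E' → isIso (fromEdges E') F) (edgeSubsets G w)) (fiveSubsets n))

ind : ∀ {n} → Graph n → Adj5 → ℕ
ind {n} G F = countB (λ w → isIso (induced G w) F) (fiveSubsets n)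

M75 M77 M79 M86 M87 M94 M95 M117 M119 M127 M222 M223 M235 M236 M237 M239 M254 M255 M507 M511 M1023 : Adj5
M75   = pat ((1 , 5) ∷ (2 , 5) ∷ (3 , 5) ∷ (4 , 5) ∷ [])
M77   = pat ((1 , 5) ∷ (2 , 5) ∷ (3 , 5) ∷ (3 , 4) ∷ [])
M79   = pat ((1 , 5) ∷ (2 , 5) ∷ (3 , 4) ∷ (3 , 5) ∷ (4 , 5) ∷ [])
M86   = pat ((1 , 5) ∷ (2 , 4) ∷ (3 , 4) ∷ (3 , 5) ∷ [])
M87   = pat ((1 , 5) ∷ (2 , 4) ∷ (3 , 4) ∷ (3 , 5) ∷ (4 , 5) ∷ [])
M94   = pat ((1 , 5) ∷ (2 , 4) ∷ (2 , 5) ∷ (3 , 4) ∷ (3 , 5) ∷ [])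
M95   = pat ((1 , 5) ∷ (2 , 4) ∷ (2 , 5) ∷ (3 , 4) ∷ (3 , 5) ∷ (4 , 5) ∷ [])
M117  = pat ((1 , 5) ∷ (2 , 3) ∷ (2 , 4) ∷ (3 , 4) ∷ (4 , 5) ∷ [])
M119  = pat ((1 , 5) ∷ (2 , 3) ∷ (2 , 4) ∷ (3 , 4) ∷ (3 , 5) ∷ (4 , 5) ∷ [])
M127  = pat ((1 , 5) ∷ (2 , 3) ∷ (2 , 4) ∷ (2 , 5) ∷ (3 , 4) ∷ (3 , 5) ∷ (4 , 5) ∷ [])
M222  = pat ((1 , 4) ∷ (1 , 5) ∷ (2 , 4) ∷ (2 , 5) ∷ (3 , 4) ∷ (3 , 5) ∷ [])
M223  = pat ((1 , 4) ∷ (1 , 5) ∷ (2 , 4) ∷ (2 , 5) ∷ (3 , 4) ∷ (3 , 5) ∷ (4 , 5) ∷ [])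
M235  = pat ((1 , 4) ∷ (1 , 5) ∷ (2 , 3) ∷ (2 , 5) ∷ (3 , 5) ∷ (4 , 5) ∷ [])
M236  = pat ((1 , 4) ∷ (1 , 5) ∷ (2 , 3) ∷ (2 , 5) ∷ (3 , 4) ∷ [])
M237  = pat ((1 , 4) ∷ (1 , 5) ∷ (2 , 3) ∷ (2 , 5) ∷ (3 , 4) ∷ (4 , 5) ∷ [])
M239  = pat ((1 , 4) ∷ (1 , 5) ∷ (2 , 3) ∷ (2 , 5) ∷ (3 , 4) ∷ (3 , 5) ∷ (4 , 5) ∷ [])
M254  = pat ((1 , 4) ∷ (1 , 5) ∷ (2 , 3) ∷ (2 , 4) ∷ (2 , 5) ∷ (3 , 4) ∷ (3 , 5) ∷ [])
M255  = pat ((1 , 4) ∷ (1 , 5) ∷ (2 , 3) ∷ (2 , 4) ∷ (2 , 5) ∷ (3 , 4) ∷ (3 , 5) ∷ (4 , 5) ∷ [])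
M507  = pat ((1 , 3) ∷ (1 , 4) ∷ (1 , 5) ∷ (2 , 3) ∷ (2 , 4) ∷ (2 , 5) ∷ (3 , 5) ∷ (4 , 5) ∷ [])
M511  = pat ((1 , 3) ∷ (1 , 4) ∷ (1 , 5) ∷ (2 , 3) ∷ (2 , 4) ∷ (2 , 5) ∷ (3 , 4) ∷ (3 , 5) ∷ (4 , 5) ∷ [])
M1023 = pat ((1 , 2) ∷ (1 , 3) ∷ (1 , 4) ∷ (1 , 5) ∷ (2 , 3) ∷ (2 , 4) ∷ (2 , 5) ∷ (3 , 4) ∷ (3 , 5) ∷ (4 , 5) ∷ [])

{-# OPTIONS --safe #-}

-- Fix a 5-subset W of V. Whether G[W] is isomorphic to F, and how many edge
-- subsets of G[W] are isomorphic to F, depend only on the 10-bit vector of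
-- adjacencies in W, and each identity of the theorem already holds for every
-- single W. The edge vectors isomorphic to F form an orbit, which is stored as
-- a binary tree of depth 10 with Boolean leaves; summing over edge subsets is
-- then the zeta transform of that tree, so the local identities are equations
-- between 1024 integers, checked by evaluation. Summation over W finishes the
-- proof, both sides being linear in the counts.

module Submission where

open import Defs
open import Data.Nat using (ℕ)
open import Data.Integer using (ℤ; +_; _+_; _-_; _*_)
open import Data.Product using (_×_)
open import Relation.Binary.PropositionalEquality using (_≡_)

open import Data.Bool using (Bool; true; false; _∧_; _∨_)
import Data.Bool.Properties as Bool
open import Data.Bool.ListAction using (all; any; or)
open import Data.Fin using (Fin; #_)
open import Data.Fin.Patterns using (0F; 1F; 2F; 3F; 4F)
import Data.Fin.Properties as Fin
import Data.Integer.Properties as ℤ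
open import Data.Integer.Tactic.RingSolver using (solve-∀)
open import Data.List using (List; []; _∷_; _++_; allFin; filter; foldr; length)
import Data.List as List
import Data.List.Properties as List
import Data.Nat as ℕ
open import Data.Nat.ListAction using (sum)
open import Data.Product using (_,_; proj₁; proj₂)
open import Data.Vec using (Vec; []; _∷_; fromList)
import Data.Vec as Vec
import Data.Vec.Properties as Vec
open import Function using (_∘_)
open import Relation.Binary.Definitions using (DecidableEquality)
open import Relation.Binary.PropositionalEquality using (refl; trans; cong; cong₂; module ≡-Reasoning)
open import Relation.Nullary.Decidable using (Dec; map′; _×-dec_; toWitness)
import Relation.Binary.PropositionalEquality as ≡

private
  variable
    A B C : Set
    k n : ℕ

-- Binary trees indexed by bit vectors, and exhaustive checks on them.

data Tree (A : Set) : ℕ → Set where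
  leaf : A → Tree A 0
  node : Tree A n → Tree A n → Tree A (ℕ.suc n)

lookup : Tree A n → Vec Bool n → A
lookup (leaf x)   []          = x
lookup (node l r) (false ∷ b) = lookup l b
lookup (node l r) (true  ∷ b) = lookup r b

mapᵀ : (A → B) → Tree A n → Tree B n
mapᵀ f (leaf x)   = leaf (f x)
mapᵀ f (node l r) = node (mapᵀ f l) (mapᵀ f r)

zipᵀ : (A → B → C) → Tree A n → Tree B n → Tree C n
zipᵀ f (leaf x)   (leaf y)     = leaf (f x y)
zipᵀ f (node l r) (node l′ r′) = node (zipᵀ f l l′) (zipᵀ f r r′)

lookup-map : (f : A → B) (t : Tree A n) (b : Vec Bool n) → lookup (mapᵀ f t) b ≡ f (lookup t b)
lookup-map f (leaf x)   []          = refl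
lookup-map f (node l r) (false ∷ b) = lookup-map f l b
lookup-map f (node l r) (true  ∷ b) = lookup-map f r b

lookup-zip : (f : A → B → C) (s : Tree A n) (t : Tree B n) (b : Vec Bool n) →
             lookup (zipᵀ f s t) b ≡ f (lookup s b) (lookup t b)
lookup-zip f (leaf x)   (leaf y)     []          = refl
lookup-zip f (node l r) (node l′ r′) (false ∷ b) = lookup-zip f l l′ b
lookup-zip f (node l r) (node l′ r′) (true  ∷ b) = lookup-zip f r r′ b

-- Branching on the first bit reduces the claim to two claims on shorter vectors. With `toWitness`,
-- a property of all 1024 edge vectors is then proved by evaluation.
∀Vec? : ∀ n {P : Vec Bool n → Set} → (∀ b → Dec (P b)) → Dec (∀ b → P b)
∀Vec? 0         P? = map′ (λ p → λ { [] → p }) (λ p → p []) (P? [])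
∀Vec? (ℕ.suc n) P? =
  map′ (λ { (p , q) → λ { (false ∷ b) → p b ; (true ∷ b) → q b } })
       (λ p → (p ∘ (false ∷_)) , (p ∘ (true ∷_)))
       (∀Vec? n (P? ∘ (false ∷_)) ×-dec ∀Vec? n (P? ∘ (true ∷_)))

-- The two trees are descended in parallel, so each pair of leaves is compared once and no lookup
-- restarts from the root.
agree? : DecidableEquality A → (s t : Tree A n) → Dec (∀ b → lookup s b ≡ lookup t b)
agree? _≟_ (leaf x)   (leaf y)     = map′ (λ p → λ { [] → p }) (λ p → p []) (x ≟ y)
agree? _≟_ (node l r) (node l′ r′) =
  map′ (λ { (p , q) → λ { (false ∷ b) → p b ; (true ∷ b) → q b } })
       (λ p → (p ∘ (false ∷_)) , (p ∘ (true ∷_)))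
       (agree? _≟_ l l′ ×-dec agree? _≟_ r r′)

-- Zeta transform and edge subsets

⟦_⟧ᵇ : Bool → ℕ
⟦ false ⟧ᵇ = 0
⟦ true  ⟧ᵇ = 1

-- A separate function so that the transform of the left half is evaluated once.
extend : Tree ℕ n → Tree ℕ n → Tree ℕ (ℕ.suc n)
extend l r = node l (zipᵀ ℕ._+_ l r)

-- This is the subset-sum transform: the new entry at `b` is the sum of the old entries over all
-- vectors bitwise below `b`. A leading `false` admits only the left half, a leading `true` admits
-- both.
zeta : Tree ℕ n → Tree ℕ n
zeta (leaf x)   = leaf x
zeta (node l r) = extend (zeta l) (zeta r)

select : (xs : List A) → Vec Bool (length xs) → List A
select []       []          = []
select (x ∷ xs) (false ∷ b) = select xs b
select (x ∷ xs) (true  ∷ b) = x ∷ select xs b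

countB-++ : (q : A → Bool) (xs ys : List A) → countB q (xs ++ ys) ≡ countB q xs ℕ.+ countB q ys
countB-++ q []       ys = refl
countB-++ q (x ∷ xs) ys with q x
... | true  = cong ℕ.suc (countB-++ q xs ys)
... | false = countB-++ q xs ys

countB-map : (q : B → Bool) (f : A → B) (xs : List A) → countB q (List.map f xs) ≡ countB (q ∘ f) xs
countB-map q f []       = refl
countB-map q f (x ∷ xs) with q (f x)
... | true  = cong ℕ.suc (countB-map q f xs)
... | false = countB-map q f xs

indicatorTree : Tree Bool n → Tree ℕ n
indicatorTree = mapᵀ ⟦_⟧ᵇ

-- Induction on `xs`. An element failing `p` is filtered out, and its `false` bit selects the left
-- half alone. An element passing `p` splits the sublists into those without it, counted by `l`, and
-- those with it, counted by `r` through `q ∘ (x ∷_)`; the transform adds the two.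
countB-sublists : (p : A → Bool) {q : List A → Bool} (xs : List A) (t : Tree Bool (length xs)) →
                  (∀ b → q (select xs b) ≡ lookup t b) →
                  countB q (sublists (filter (Bool.T? ∘ p) xs)) ≡
                  lookup (zeta (indicatorTree t)) (Vec.map p (fromList xs))
countB-sublists p {q} [] (leaf y) q≗ with q [] | q≗ []
... | true  | refl = refl
... | false | refl = refl
countB-sublists p {q} (x ∷ xs) (node l r) q≗ with p x
... | false = countB-sublists p xs l (q≗ ∘ (false ∷_))
... | true  = begin
  countB q (ys ++ List.map (x ∷_) ys)           ≡⟨ countB-++ q ys _ ⟩
  countB q ys ℕ.+ countB q (List.map (x ∷_) ys) ≡⟨ cong (countB q ys ℕ.+_) (countB-map q (x ∷_) ys) ⟩
  countB q ys ℕ.+ countB (q ∘ (x ∷_)) ys        ≡⟨ cong₂ ℕ._+_ (countB-sublists p xs l (q≗ ∘ (false ∷_)))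
                                                              (countB-sublists p xs r (q≗ ∘ (true ∷_))) ⟩
  lookup s b ℕ.+ lookup t b                     ≡⟨ lookup-zip ℕ._+_ s t b ⟨
  lookup (zipᵀ ℕ._+_ s t) b                     ∎
  where
  open ≡-Reasoning
  ys = sublists (filter (Bool.T? ∘ p) xs)
  b  = Vec.map p (fromList xs)
  s  = zeta (indicatorTree l)
  t  = zeta (indicatorTree r)

-- Isomorphism classes as trees

empty : ∀ n → Tree Bool n
empty 0         = leaf false
empty (ℕ.suc n) = node (empty n) (empty n)

-- Overwriting the leaf makes insertion idempotent, so the tree represents a set. Permutations that
-- differ by an automorphism of the pattern yield the same edge vector, which must not be counted
-- twice.
insert : Vec Bool n → Tree Bool n → Tree Bool n
insert []          (leaf _)   = leaf true
insert (false ∷ c) (node l r) = node (insert c l) r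
insert (true  ∷ c) (node l r) = node l (insert c r)

eqVec : Vec Bool n → Vec Bool n → Bool
eqVec []      []      = true
eqVec (x ∷ b) (y ∷ c) = eqB x y ∧ eqVec b c

lookup-empty : (b : Vec Bool n) → lookup (empty n) b ≡ false
lookup-empty []          = refl
lookup-empty (false ∷ b) = lookup-empty b
lookup-empty (true  ∷ b) = lookup-empty b

lookup-insert : (c : Vec Bool n) (t : Tree Bool n) (b : Vec Bool n) →
                lookup (insert c t) b ≡ eqVec b c ∨ lookup t b
lookup-insert []          (leaf _)   []          = refl
lookup-insert (false ∷ c) (node l r) (false ∷ b) = lookup-insert c l b
lookup-insert (false ∷ c) (node l r) (true  ∷ b) = refl
lookup-insert (true  ∷ c) (node l r) (false ∷ b) = refl
lookup-insert (true  ∷ c) (node l r) (true  ∷ b) = lookup-insert c r b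

-- Adjacency tables and their ten edge bits.

relabel : Adj5 → (Fin 5 → Fin 5) → Adj5
relabel F σ i j = F (σ i) (σ j)

edgeBits : Adj5 → Vec Bool 10
edgeBits H = Vec.map (λ e → H (proj₁ e) (proj₂ e)) (fromList pairs5)

orbitTree : List (Fin 5 → Fin 5) → Adj5 → Tree Bool 10
orbitTree σs F = foldr (insert ∘ edgeBits ∘ relabel F) (empty 10) σs

lookup-orbitTree : ∀ σs F b → lookup (orbitTree σs F) b ≡ any (eqVec b ∘ edgeBits ∘ relabel F) σs
lookup-orbitTree []       F b = lookup-empty b
lookup-orbitTree (σ ∷ σs) F b =
  trans (lookup-insert (edgeBits (relabel F σ)) (orbitTree σs F) b)
        (cong (eqVec b (edgeBits (relabel F σ)) ∨_) (lookup-orbitTree σs F b))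

-- `isIso` compares all 25 entries of two tables, while `edgeBits` keeps the ten above the diagonal.
-- Under these two conditions the ten determine the rest.
record Simple (H : Adj5) : Set where
  field
    symmetric   : ∀ i j → H i j ≡ H j i
    irreflexive : ∀ i → H i i ≡ false
open Simple

relabel-simple : ∀ {F} → Simple F → ∀ σ → Simple (relabel F σ)
relabel-simple sF σ .symmetric i j = sF .symmetric (σ i) (σ j)
relabel-simple sF σ .irreflexive i = sF .irreflexive (σ i)

sameAdj : Adj5 → Adj5 → Bool
sameAdj H K = all (λ i → all (λ j → eqB (H i j) (K i j)) (allFin 5)) (allFin 5)

-- The left side is the row-by-row comparison of two simple tables, with the diagonal removed and
-- each remaining entry occurring twice; the right side is `eqVec` unfolded. At the first `false`
-- both sides compute to `false`, so eleven cases suffice.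
∧-upperTriangle : ∀ a b c d e f g h i j →
  (a ∧ b ∧ c ∧ d ∧ true) ∧ (a ∧ e ∧ f ∧ g ∧ true) ∧ (b ∧ e ∧ h ∧ i ∧ true) ∧
    (c ∧ f ∧ h ∧ j ∧ true) ∧ (d ∧ g ∧ i ∧ j ∧ true) ∧ true ≡
  a ∧ b ∧ c ∧ d ∧ e ∧ f ∧ g ∧ h ∧ i ∧ j ∧ true
∧-upperTriangle false _ _ _ _ _ _ _ _ _ = refl
∧-upperTriangle true false _ _ _ _ _ _ _ _ = refl
∧-upperTriangle true true false _ _ _ _ _ _ _ = refl
∧-upperTriangle true true true false _ _ _ _ _ _ = refl
∧-upperTriangle true true true true false _ _ _ _ _ = refl
∧-upperTriangle true true true true true false _ _ _ _ = refl
∧-upperTriangle true true true true true true false _ _ _ = refl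
∧-upperTriangle true true true true true true true false _ _ = refl
∧-upperTriangle true true true true true true true true false _ = refl
∧-upperTriangle true true true true true true true true true false = refl
∧-upperTriangle true true true true true true true true true true = refl

sameAdj-edgeBits : ∀ {H K} → Simple H → Simple K → sameAdj H K ≡ eqVec (edgeBits H) (edgeBits K)
sameAdj-edgeBits {H} {K} sH sK
  rewrite sH .irreflexive 0F | sH .irreflexive 1F | sH .irreflexive 2F | sH .irreflexive 3F | sH .irreflexive 4F
        | sK .irreflexive 0F | sK .irreflexive 1F | sK .irreflexive 2F | sK .irreflexive 3F | sK .irreflexive 4F
        | sH .symmetric 1F 0F | sH .symmetric 2F 0F | sH .symmetric 3F 0F | sH .symmetric 4F 0F | sH .symmetric 2F 1F
        | sH .symmetric 3F 1F | sH .symmetric 4F 1F | sH .symmetric 3F 2F | sH .symmetric 4F 2F | sH .symmetric 4F 3F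
        | sK .symmetric 1F 0F | sK .symmetric 2F 0F | sK .symmetric 3F 0F | sK .symmetric 4F 0F | sK .symmetric 2F 1F
        | sK .symmetric 3F 1F | sK .symmetric 4F 1F | sK .symmetric 3F 2F | sK .symmetric 4F 2F | sK .symmetric 4F 3F
  = ∧-upperTriangle (e 0F 1F) (e 0F 2F) (e 0F 3F) (e 0F 4F) (e 1F 2F) (e 1F 3F) (e 1F 4F) (e 2F 3F) (e 2F 4F) (e 3F 4F)
  where
  e : Adj5
  e i j = eqB (H i j) (K i j)

Decides : Tree Bool 10 → (Adj5 → Bool) → Set
Decides t q = ∀ {H} → Simple H → q H ≡ lookup t (edgeBits H)

isIsoVia : List (Fin 5 → Fin 5) → Adj5 → Adj5 → Bool
isIsoVia σs F H = any (λ σ → sameAdj H (relabel F σ)) σs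

orbitTree-decides : ∀ σs {F} → Simple F → Decides (orbitTree σs F) (isIsoVia σs F)
orbitTree-decides σs {F} sF {H} sH =
  trans (cong or (List.map-cong (λ σ → sameAdj-edgeBits sH (relabel-simple sF σ)) σs))
        (≡.sym (lookup-orbitTree σs F (edgeBits H)))

fromEdges-sym : ∀ es i j → fromEdges es i j ≡ fromEdges es j i
fromEdges-sym []       i j = refl
fromEdges-sym (e ∷ es) i j =
  cong₂ _∨_ (Bool.∨-comm ((proj₁ e == i) ∧ (proj₂ e == j)) _) (fromEdges-sym es i j)

-- `select` and `edgeBits` both follow the order of `pairs5`, which contains each unordered pair
-- once. Hence vectors can stand for edge subsets.
edgeBits-select : ∀ b → edgeBits (fromEdges (select pairs5 b)) ≡ b
edgeBits-select =
  toWitness {a? = ∀Vec? 10 λ b → Vec.≡-dec Bool._≟_ (edgeBits (fromEdges (select pairs5 b))) b} _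

-- Symmetry holds for every edge list, but a list containing a loop would violate irreflexivity;
-- that half is therefore checked on the sublists of `pairs5` only.
select-simple : ∀ b → Simple (fromEdges (select pairs5 b))
select-simple b .symmetric   = fromEdges-sym (select pairs5 b)
select-simple b .irreflexive =
  toWitness {a? = ∀Vec? 10 λ b → Fin.all? λ i → fromEdges (select pairs5 b) i i Bool.≟ false} _ b

induced-simple : (G : Graph n) (w : Fin 5 → Fin n) → Simple (induced G w)
induced-simple G w .symmetric i j = sym G (w i) (w j)
induced-simple G w .irreflexive i = irrefl G (w i)

countTree : Tree Bool n → Tree ℤ n
countTree = mapᵀ +_ ∘ zeta ∘ indicatorTree

-- The vectors below the edge vector of the induced graph are exactly its edge subsets, so the
-- transform of the 0/1 orbit tree counts those in the orbit.
countB-edgeSubsets : ∀ t q → Decides t q → (G : Graph n) (w : Fin 5 → Fin n) →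
  + countB (q ∘ fromEdges) (edgeSubsets G w) ≡ lookup (countTree t) (edgeBits (induced G w))
countB-edgeSubsets t q t-decides-q G w =
  trans (cong +_ (countB-sublists (λ e → induced G w (proj₁ e) (proj₂ e)) pairs5 t λ b →
          trans (t-decides-q (select-simple b)) (cong (lookup t) (edgeBits-select b))))
        (≡.sym (lookup-map +_ (zeta (indicatorTree t)) (edgeBits (induced G w))))

-- Linear forms

infixl 6 _:+_ _:-_
infixr 7 _:*_

-- Reified so that one expression can be evaluated both at integers and at whole trees. There is no
-- constant term, which makes evaluation additive.
data Form (k : ℕ) : Set where
  var       : Fin k → Form k
  _:+_ _:-_ : Form k → Form k → Form k
  _:*_      : ℤ → Form k → Form k

eval : Form k → (Fin k → ℤ) → ℤ
eval (var a)  ρ = ρ a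
eval (e :+ f) ρ = eval e ρ + eval f ρ
eval (e :- f) ρ = eval e ρ - eval f ρ
eval (c :* e) ρ = c * eval e ρ

evalᵀ : Form k → Vec (Tree ℤ n) k → Tree ℤ n
evalᵀ (var a)  ts = Vec.lookup ts a
evalᵀ (e :+ f) ts = zipᵀ _+_ (evalᵀ e ts) (evalᵀ f ts)
evalᵀ (e :- f) ts = zipᵀ _-_ (evalᵀ e ts) (evalᵀ f ts)
evalᵀ (c :* e) ts = mapᵀ (c *_) (evalᵀ e ts)

lookup-evalᵀ : (e : Form k) (ts : Vec (Tree ℤ n) k) (b : Vec Bool n) →
               lookup (evalᵀ e ts) b ≡ eval e (λ a → lookup (Vec.lookup ts a) b)
lookup-evalᵀ (var a)  ts b = refl
lookup-evalᵀ (e :+ f) ts b =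
  trans (lookup-zip _+_ (evalᵀ e ts) _ b) (cong₂ _+_ (lookup-evalᵀ e ts b) (lookup-evalᵀ f ts b))
lookup-evalᵀ (e :- f) ts b =
  trans (lookup-zip _-_ (evalᵀ e ts) _ b) (cong₂ _-_ (lookup-evalᵀ e ts b) (lookup-evalᵀ f ts b))
lookup-evalᵀ (c :* e) ts b =
  trans (lookup-map (c *_) (evalᵀ e ts) b) (cong (c *_) (lookup-evalᵀ e ts b))

eval-cong : (e : Form k) {ρ ρ′ : Fin k → ℤ} → (∀ a → ρ a ≡ ρ′ a) → eval e ρ ≡ eval e ρ′
eval-cong (var a)  ρ≗ = ρ≗ a
eval-cong (e :+ f) ρ≗ = cong₂ _+_ (eval-cong e ρ≗) (eval-cong f ρ≗)
eval-cong (e :- f) ρ≗ = cong₂ _-_ (eval-cong e ρ≗) (eval-cong f ρ≗)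
eval-cong (c :* e) ρ≗ = cong (c *_) (eval-cong e ρ≗)

eval-zero : (e : Form k) → eval e (λ _ → + 0) ≡ + 0
eval-zero (var a)  = refl
eval-zero (e :+ f) = cong₂ _+_ (eval-zero e) (eval-zero f)
eval-zero (e :- f) = cong₂ _-_ (eval-zero e) (eval-zero f)
eval-zero (c :* e) = trans (cong (c *_) (eval-zero e)) (ℤ.*-zeroʳ c)

eval-+ : (e : Form k) (ρ ρ′ : Fin k → ℤ) → eval e (λ a → ρ a + ρ′ a) ≡ eval e ρ + eval e ρ′
eval-+ (var a)  ρ ρ′ = refl
eval-+ (e :+ f) ρ ρ′ = trans (cong₂ _+_ (eval-+ e ρ ρ′) (eval-+ f ρ ρ′)) (interchange (eval e ρ) _ _ _)
  where
  interchange : ∀ x y z t → (x + y) + (z + t) ≡ (x + z) + (y + t)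
  interchange = solve-∀
eval-+ (e :- f) ρ ρ′ = trans (cong₂ _-_ (eval-+ e ρ ρ′) (eval-+ f ρ ρ′)) (interchange (eval e ρ) _ _ _)
  where
  interchange : ∀ x y z t → (x + y) - (z + t) ≡ (x - z) + (y - t)
  interchange = solve-∀
eval-+ (c :* e) ρ ρ′ = trans (cong (c *_) (eval-+ e ρ ρ′)) (ℤ.*-distribˡ-+ c (eval e ρ) (eval e ρ′))

-- Finite integer sums and their exchange with linear forms.

∑ : List A → (A → ℤ) → ℤ
∑ []       f = + 0
∑ (x ∷ xs) f = f x + ∑ xs f

∑-cong : (xs : List A) {f g : A → ℤ} → (∀ x → f x ≡ g x) → ∑ xs f ≡ ∑ xs g
∑-cong []       f≗g = refl
∑-cong (x ∷ xs) f≗g = cong₂ _+_ (f≗g x) (∑-cong xs f≗g)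

-- A form vanishes at the zero assignment, which settles the empty list; additivity settles the
-- inductive step.
∑-eval : (e : Form k) (xs : List A) (ρ : A → Fin k → ℤ) →
         ∑ xs (λ x → eval e (ρ x)) ≡ eval e (λ a → ∑ xs (λ x → ρ x a))
∑-eval e []       ρ = ≡.sym (eval-zero e)
∑-eval e (x ∷ xs) ρ = trans (cong (λ s → eval e (ρ x) + s) (∑-eval e xs ρ)) (≡.sym (eval-+ e (ρ x) _))

∑-sum : (xs : List A) (f : A → ℕ) → + sum (List.map f xs) ≡ ∑ xs (+_ ∘ f)
∑-sum []       f = refl
∑-sum (x ∷ xs) f = trans (ℤ.pos-+ (f x) _) (cong (λ s → + f x + s) (∑-sum xs f))

∑-countB : (p : A → Bool) (xs : List A) → + countB p xs ≡ ∑ xs (λ x → + ⟦ p x ⟧ᵇ)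
∑-countB p []       = refl
∑-countB p (x ∷ xs) with p x
... | true  = trans (ℤ.pos-+ 1 (countB p xs)) (cong (λ s → + 1 + s) (∑-countB p xs))
... | false = trans (∑-countB p xs) (≡.sym (ℤ.+-identityˡ _))

-- The 21 patterns and their identities

patterns : Vec Adj5 21
patterns =
  M75 ∷ M77 ∷ M79 ∷ M86 ∷ M87 ∷ M94 ∷ M95 ∷ M117 ∷ M119 ∷ M127 ∷
  M222 ∷ M223 ∷ M235 ∷ M236 ∷ M237 ∷ M239 ∷ M254 ∷ M255 ∷ M507 ∷ M511 ∷ M1023 ∷ []

patterns-simple : ∀ a → Simple (Vec.lookup patterns a)
patterns-simple a .symmetric =
  toWitness {a? = Fin.all? λ a → Fin.all? λ i → Fin.all? λ j →
    Vec.lookup patterns a i j Bool.≟ Vec.lookup patterns a j i} _ a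
patterns-simple a .irreflexive =
  toWitness {a? = Fin.all? λ a → Fin.all? λ i → Vec.lookup patterns a i i Bool.≟ false} _ a

m75 m77 m79 m86 m87 m94 m95 m117 m119 m127 m222 m223 m235 m236 m237 m239 m254 m255 m507 m511 m1023 : Form 21
m75   = var (# 0)
m77   = var (# 1)
m79   = var (# 2)
m86   = var (# 3)
m87   = var (# 4)
m94   = var (# 5)
m95   = var (# 6)
m117  = var (# 7)
m119  = var (# 8)
m127  = var (# 9)
m222  = var (# 10)
m223  = var (# 11)
m235  = var (# 12)
m236  = var (# 13)
m237  = var (# 14)
m239  = var (# 15)
m254  = var (# 16)
m255  = var (# 17)
m507  = var (# 18)
m511  = var (# 19)
m1023 = var (# 20)

-- Row `a` is a Möbius inversion: the coefficient of pattern `c` is the number of spanning copies of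
-- pattern `a` in it, with sign given by the parity of the difference in edge numbers. The 21
-- patterns are the connected graphs on five vertices, a family closed under adding edges, so no
-- other graphs enter.
forms : Vec (Form 21) 21
forms =
  (m75 :- m79 :+ m95 :- m127 :- + 2 :* m223 :+ m235 :- m239 :+ + 2 :* m255 :+ m507 :- + 3 :* m511 :+ + 5 :* m1023) ∷
  (m77 :- + 2 :* m79 :- + 2 :* m87 :- + 2 :* m94 :+ + 5 :* m95 :- m117 :+ + 4 :* m119 :- + 9 :* m127 :+ + 6 :* m222 :- + 12 :* m223 :+ + 4 :* m235 :+ + 4 :* m237 :- + 10 :* m239 :- + 10 :* m254 :+ + 20 :* m255 :+ + 20 :* m507 :- + 36 :* m511 :+ + 60 :* m1023) ∷
  (m79 :- + 2 :* m95 :+ + 3 :* m127 :+ + 6 :* m223 :- + 2 :* m235 :+ + 3 :* m239 :- + 8 :* m255 :- + 4 :* m507 :+ + 15 :* m511 :- + 30 :* m1023) ∷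
  (m86 :- m87 :- + 2 :* m94 :+ + 2 :* m95 :- + 2 :* m117 :+ + 4 :* m119 :- + 6 :* m127 :+ + 6 :* m222 :- + 6 :* m223 :+ + 4 :* m235 :- + 5 :* m236 :+ + 7 :* m237 :- + 10 :* m239 :- + 14 :* m254 :+ + 18 :* m255 :+ + 24 :* m507 :- + 36 :* m511 :+ + 60 :* m1023) ∷
  (m87 :- + 2 :* m95 :- + 2 :* m119 :+ + 6 :* m127 :+ + 6 :* m223 :- m237 :+ + 5 :* m239 :+ + 4 :* m254 :- + 14 :* m255 :- + 12 :* m507 :+ + 30 :* m511 :- + 60 :* m1023) ∷
  (m94 :- m95 :- m119 :+ + 3 :* m127 :- + 6 :* m222 :+ + 6 :* m223 :- + 2 :* m237 :+ + 4 :* m239 :+ + 8 :* m254 :- + 12 :* m255 :- + 16 :* m507 :+ + 30 :* m511 :- + 60 :* m1023) ∷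
  (m95 :- + 3 :* m127 :- + 6 :* m223 :- + 2 :* m239 :+ + 10 :* m255 :+ + 4 :* m507 :- + 24 :* m511 :+ + 60 :* m1023) ∷
  (m117 :- + 2 :* m119 :+ + 3 :* m127 :- + 4 :* m235 :- + 2 :* m237 :+ + 6 :* m239 :+ + 6 :* m254 :- + 12 :* m255 :- + 16 :* m507 :+ + 30 :* m511 :- + 60 :* m1023) ∷
  (m119 :- + 3 :* m127 :- + 2 :* m239 :- + 2 :* m254 :+ + 8 :* m255 :+ + 8 :* m507 :- + 24 :* m511 :+ + 60 :* m1023) ∷
  (m127 :- + 2 :* m255 :+ + 6 :* m511 :- + 20 :* m1023) ∷
  (m222 :- m223 :- m254 :+ m255 :+ + 2 :* m507 :- + 4 :* m511 :+ + 10 :* m1023) ∷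
  (m223 :- m255 :+ + 3 :* m511 :- + 10 :* m1023) ∷
  (m235 :- m239 :+ + 2 :* m255 :+ + 2 :* m507 :- + 6 :* m511 :+ + 15 :* m1023) ∷
  (m236 :- m237 :+ m239 :+ + 2 :* m254 :- + 2 :* m255 :- + 4 :* m507 :+ + 6 :* m511 :- + 12 :* m1023) ∷
  (m237 :- + 2 :* m239 :- + 4 :* m254 :+ + 6 :* m255 :+ + 12 :* m507 :- + 24 :* m511 :+ + 60 :* m1023) ∷
  (m239 :- + 4 :* m255 :- + 4 :* m507 :+ + 18 :* m511 :- + 60 :* m1023) ∷
  (m254 :- m255 :- + 4 :* m507 :+ + 9 :* m511 :- + 30 :* m1023) ∷
  (m255 :- + 6 :* m511 :+ + 30 :* m1023) ∷
  (m507 :- + 3 :* m511 :+ + 15 :* m1023) ∷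
  (m511 :- + 10 :* m1023) ∷
  (m1023) ∷
  []

-- The identities on a single five-set.

orbitTrees : List (Fin 5 → Fin 5) → Vec (Tree Bool 10) 21
orbitTrees σs = Vec.map (orbitTree σs) patterns

Identities : Vec (Tree Bool n) k → Vec (Tree ℤ n) k → Vec (Form k) k → Set
Identities {n} ts zs es =
  ∀ a (b : Vec Bool n) → lookup (mapᵀ (+_ ∘ ⟦_⟧ᵇ) (Vec.lookup ts a)) b ≡ lookup (evalᵀ (Vec.lookup es a) zs) b

-- The trees are arguments so that evaluation shares them between the identities.
identities? : (ts : Vec (Tree Bool n) k) (zs : Vec (Tree ℤ n) k) (es : Vec (Form k) k) → Dec (Identities ts zs es)
identities? ts zs es = Fin.all? λ a → agree? ℤ._≟_ (mapᵀ (+_ ∘ ⟦_⟧ᵇ) (Vec.lookup ts a)) (evalᵀ (Vec.lookup es a) zs)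

localIdentities? : (ts : Vec (Tree Bool n) k) (es : Vec (Form k) k) → Dec (Identities ts (Vec.map countTree ts) es)
localIdentities? ts es = identities? ts (Vec.map countTree ts) es

-- The coefficients are verified here: each of the 21 rows is compared at all 1024 edge vectors, and
-- the decision evaluates to a positive answer.
localIdentities : Identities (orbitTrees perms5) (Vec.map countTree (orbitTrees perms5)) forms
localIdentities = toWitness {a? = localIdentities? (orbitTrees perms5) forms} _

-- The trees are variables here to keep the type checker from evaluating them.
localIdentity : (ts : Vec (Tree Bool 10) k) (qs : Fin k → Adj5 → Bool) (es : Vec (Form k) k) →
  Identities ts (Vec.map countTree ts) es → (∀ a → Decides (Vec.lookup ts a) (qs a)) →
  (G : Graph n) (w : Fin 5 → Fin n) (a : Fin k) →
  + ⟦ qs a (induced G w) ⟧ᵇ ≡ eval (Vec.lookup es a) (λ c → + countB (qs c ∘ fromEdges) (edgeSubsets G w))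
localIdentity ts qs es identities decides G w a = begin
  + ⟦ qs a (induced G w) ⟧ᵇ
    ≡⟨ cong (+_ ∘ ⟦_⟧ᵇ) (decides a (induced-simple G w)) ⟩
  + ⟦ lookup (Vec.lookup ts a) b ⟧ᵇ
    ≡⟨ lookup-map (+_ ∘ ⟦_⟧ᵇ) (Vec.lookup ts a) b ⟨
  lookup (mapᵀ (+_ ∘ ⟦_⟧ᵇ) (Vec.lookup ts a)) b
    ≡⟨ identities a b ⟩
  lookup (evalᵀ (Vec.lookup es a) (Vec.map countTree ts)) b
    ≡⟨ lookup-evalᵀ (Vec.lookup es a) (Vec.map countTree ts) b ⟩
  eval (Vec.lookup es a) (λ c → lookup (Vec.lookup (Vec.map countTree ts) c) b)
    ≡⟨ eval-cong (Vec.lookup es a) counts ⟩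
  eval (Vec.lookup es a) (λ c → + countB (qs c ∘ fromEdges) (edgeSubsets G w)) ∎
  where
  open ≡-Reasoning
  b = edgeBits (induced G w)
  counts : ∀ c → lookup (Vec.lookup (Vec.map countTree ts) c) b ≡ + countB (qs c ∘ fromEdges) (edgeSubsets G w)
  counts c = trans (cong (λ t → lookup t b) (Vec.lookup-map c countTree ts))
                   (≡.sym (countB-edgeSubsets (Vec.lookup ts c) (qs c) (decides c) G w))

orbitTrees-decide : ∀ σs a → Decides (Vec.lookup (orbitTrees σs) a) (isIsoVia σs (Vec.lookup patterns a))
orbitTrees-decide σs a {H} sH =
  trans (orbitTree-decides σs (patterns-simple a) sH)
        (cong (λ t → lookup t (edgeBits H)) (≡.sym (Vec.lookup-map a (orbitTree σs) patterns)))

-- Summation over all five-sets.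

inducedCount : (G : Graph n) (a : Fin 21) →
  + ind G (Vec.lookup patterns a) ≡
  eval (Vec.lookup forms a) (λ c → + nonInd G (Vec.lookup patterns c))
inducedCount {n} G a = begin
  + ind G (Vec.lookup patterns a)                   ≡⟨ ∑-countB (λ w → iso a (induced G w)) ws ⟩
  ∑ ws (λ w → + ⟦ iso a (induced G w) ⟧ᵇ)           ≡⟨ ∑-cong ws local ⟩
  ∑ ws (λ w → eval e (λ c → + count c w))           ≡⟨ ∑-eval e ws (λ w c → + count c w) ⟩
  -- `nonInd` is by definition the `sum` of the local counts over `ws`.
  eval e (λ c → ∑ ws (λ w → + count c w))           ≡⟨ eval-cong e (λ c → ∑-sum ws (count c)) ⟨
  eval e (λ c → + nonInd G (Vec.lookup patterns c)) ∎
  where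
  open ≡-Reasoning
  ws = fiveSubsets n
  e  = Vec.lookup forms a
  iso : Fin 21 → Adj5 → Bool
  iso c H = isIso H (Vec.lookup patterns c)
  count : Fin 21 → (Fin 5 → Fin n) → ℕ
  count c w = countB (iso c ∘ fromEdges) (edgeSubsets G w)
  local : ∀ w → + ⟦ iso a (induced G w) ⟧ᵇ ≡ eval e (λ c → + count c w)
  -- `isIsoVia perms5 F H` unfolds to `isIso H F`, so `orbitTrees-decide` applies to `iso` as it
  -- stands.
  local w = localIdentity (orbitTrees perms5) iso forms localIdentities (orbitTrees-decide perms5) G w a

-- Stated for arbitrary functions I and N because comparing the two sides at
-- the actual counts would make the type checker unfold the counts themselves.
expandForms : (I N : Adj5 → ℤ) →
  (∀ a → I (Vec.lookup patterns a) ≡ eval (Vec.lookup forms a) (λ c → N (Vec.lookup patterns c))) →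
      I M75 ≡ N M75 - N M79 + N M95 - N M127 - + 2 * N M223 + N M235 - N M239 + + 2 * N M255 + N M507 - + 3 * N M511 + + 5 * N M1023
    × I M77 ≡ N M77 - + 2 * N M79 - + 2 * N M87 - + 2 * N M94 + + 5 * N M95 - N M117 + + 4 * N M119 - + 9 * N M127 + + 6 * N M222 - + 12 * N M223 + + 4 * N M235 + + 4 * N M237 - + 10 * N M239 - + 10 * N M254 + + 20 * N M255 + + 20 * N M507 - + 36 * N M511 + + 60 * N M1023
    × I M79 ≡ N M79 - + 2 * N M95 + + 3 * N M127 + + 6 * N M223 - + 2 * N M235 + + 3 * N M239 - + 8 * N M255 - + 4 * N M507 + + 15 * N M511 - + 30 * N M1023
    × I M86 ≡ N M86 - N M87 - + 2 * N M94 + + 2 * N M95 - + 2 * N M117 + + 4 * N M119 - + 6 * N M127 + + 6 * N M222 - + 6 * N M223 + + 4 * N M235 - + 5 * N M236 + + 7 * N M237 - + 10 * N M239 - + 14 * N M254 + + 18 * N M255 + + 24 * N M507 - + 36 * N M511 + + 60 * N M1023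
    × I M87 ≡ N M87 - + 2 * N M95 - + 2 * N M119 + + 6 * N M127 + + 6 * N M223 - N M237 + + 5 * N M239 + + 4 * N M254 - + 14 * N M255 - + 12 * N M507 + + 30 * N M511 - + 60 * N M1023
    × I M94 ≡ N M94 - N M95 - N M119 + + 3 * N M127 - + 6 * N M222 + + 6 * N M223 - + 2 * N M237 + + 4 * N M239 + + 8 * N M254 - + 12 * N M255 - + 16 * N M507 + + 30 * N M511 - + 60 * N M1023
    × I M95 ≡ N M95 - + 3 * N M127 - + 6 * N M223 - + 2 * N M239 + + 10 * N M255 + + 4 * N M507 - + 24 * N M511 + + 60 * N M1023
    × I M117 ≡ N M117 - + 2 * N M119 + + 3 * N M127 - + 4 * N M235 - + 2 * N M237 + + 6 * N M239 + + 6 * N M254 - + 12 * N M255 - + 16 * N M507 + + 30 * N M511 - + 60 * N M1023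
    × I M119 ≡ N M119 - + 3 * N M127 - + 2 * N M239 - + 2 * N M254 + + 8 * N M255 + + 8 * N M507 - + 24 * N M511 + + 60 * N M1023
    × I M127 ≡ N M127 - + 2 * N M255 + + 6 * N M511 - + 20 * N M1023
    × I M222 ≡ N M222 - N M223 - N M254 + N M255 + + 2 * N M507 - + 4 * N M511 + + 10 * N M1023
    × I M223 ≡ N M223 - N M255 + + 3 * N M511 - + 10 * N M1023
    × I M235 ≡ N M235 - N M239 + + 2 * N M255 + + 2 * N M507 - + 6 * N M511 + + 15 * N M1023
    × I M236 ≡ N M236 - N M237 + N M239 + + 2 * N M254 - + 2 * N M255 - + 4 * N M507 + + 6 * N M511 - + 12 * N M1023
    × I M237 ≡ N M237 - + 2 * N M239 - + 4 * N M254 + + 6 * N M255 + + 12 * N M507 - + 24 * N M511 + + 60 * N M1023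
    × I M239 ≡ N M239 - + 4 * N M255 - + 4 * N M507 + + 18 * N M511 - + 60 * N M1023
    × I M254 ≡ N M254 - N M255 - + 4 * N M507 + + 9 * N M511 - + 30 * N M1023
    × I M255 ≡ N M255 - + 6 * N M511 + + 30 * N M1023
    × I M507 ≡ N M507 - + 3 * N M511 + + 15 * N M1023
    × I M511 ≡ N M511 - + 10 * N M1023
    × I M1023 ≡ N M1023
expandForms I N eq =
    eq (# 0)
  , eq (# 1)
  , eq (# 2)
  , eq (# 3)
  , eq (# 4)
  , eq (# 5)
  , eq (# 6)
  , eq (# 7)
  , eq (# 8)
  , eq (# 9)
  , eq (# 10)
  , eq (# 11)
  , eq (# 12)
  , eq (# 13)
  , eq (# 14)
  , eq (# 15)
  , eq (# 16)
  , eq (# 17)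
  , eq (# 18)
  , eq (# 19)
  , eq (# 20)

theorem2 : (n : ℕ) (G : Graph n) →
    let N : Adj5 → ℤ
        N F = + nonInd G F
        I : Adj5 → ℤ
        I F = + ind G F
    in    I M75 ≡ N M75 - N M79 + N M95 - N M127 - + 2 * N M223 + N M235 - N M239 + + 2 * N M255 + N M507 - + 3 * N M511 + + 5 * N M1023
      × I M77 ≡ N M77 - + 2 * N M79 - + 2 * N M87 - + 2 * N M94 + + 5 * N M95 - N M117 + + 4 * N M119 - + 9 * N M127 + + 6 * N M222 - + 12 * N M223 + + 4 * N M235 + + 4 * N M237 - + 10 * N M239 - + 10 * N M254 + + 20 * N M255 + + 20 * N M507 - + 36 * N M511 + + 60 * N M1023
      × I M79 ≡ N M79 - + 2 * N M95 + + 3 * N M127 + + 6 * N M223 - + 2 * N M235 + + 3 * N M239 - + 8 * N M255 - + 4 * N M507 + + 15 * N M511 - + 30 * N M1023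
      × I M86 ≡ N M86 - N M87 - + 2 * N M94 + + 2 * N M95 - + 2 * N M117 + + 4 * N M119 - + 6 * N M127 + + 6 * N M222 - + 6 * N M223 + + 4 * N M235 - + 5 * N M236 + + 7 * N M237 - + 10 * N M239 - + 14 * N M254 + + 18 * N M255 + + 24 * N M507 - + 36 * N M511 + + 60 * N M1023
      × I M87 ≡ N M87 - + 2 * N M95 - + 2 * N M119 + + 6 * N M127 + + 6 * N M223 - N M237 + + 5 * N M239 + + 4 * N M254 - + 14 * N M255 - + 12 * N M507 + + 30 * N M511 - + 60 * N M1023
      × I M94 ≡ N M94 - N M95 - N M119 + + 3 * N M127 - + 6 * N M222 + + 6 * N M223 - + 2 * N M237 + + 4 * N M239 + + 8 * N M254 - + 12 * N M255 - + 16 * N M507 + + 30 * N M511 - + 60 * N M1023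
      × I M95 ≡ N M95 - + 3 * N M127 - + 6 * N M223 - + 2 * N M239 + + 10 * N M255 + + 4 * N M507 - + 24 * N M511 + + 60 * N M1023
      × I M117 ≡ N M117 - + 2 * N M119 + + 3 * N M127 - + 4 * N M235 - + 2 * N M237 + + 6 * N M239 + + 6 * N M254 - + 12 * N M255 - + 16 * N M507 + + 30 * N M511 - + 60 * N M1023
      × I M119 ≡ N M119 - + 3 * N M127 - + 2 * N M239 - + 2 * N M254 + + 8 * N M255 + + 8 * N M507 - + 24 * N M511 + + 60 * N M1023
      × I M127 ≡ N M127 - + 2 * N M255 + + 6 * N M511 - + 20 * N M1023
      × I M222 ≡ N M222 - N M223 - N M254 + N M255 + + 2 * N M507 - + 4 * N M511 + + 10 * N M1023
      × I M223 ≡ N M223 - N M255 + + 3 * N M511 - + 10 * N M1023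
      × I M235 ≡ N M235 - N M239 + + 2 * N M255 + + 2 * N M507 - + 6 * N M511 + + 15 * N M1023
      × I M236 ≡ N M236 - N M237 + N M239 + + 2 * N M254 - + 2 * N M255 - + 4 * N M507 + + 6 * N M511 - + 12 * N M1023
      × I M237 ≡ N M237 - + 2 * N M239 - + 4 * N M254 + + 6 * N M255 + + 12 * N M507 - + 24 * N M511 + + 60 * N M1023
      × I M239 ≡ N M239 - + 4 * N M255 - + 4 * N M507 + + 18 * N M511 - + 60 * N M1023
      × I M254 ≡ N M254 - N M255 - + 4 * N M507 + + 9 * N M511 - + 30 * N M1023
      × I M255 ≡ N M255 - + 6 * N M511 + + 30 * N M1023
      × I M507 ≡ N M507 - + 3 * N M511 + + 15 * N M1023
      × I M511 ≡ N M511 - + 10 * N M1023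
      × I M1023 ≡ N M1023
theorem2 n G = expandForms (λ F → + ind G F) (λ F → + nonInd G F) (inducedCount G)
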